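{- Let $0<\alpha\le 1/3$, $0<\beta<1$, and $\delta:=\frac{\alpha\beta}{6}$. Then $\mathbf{Bad}(\delta)$ is an $(\alpha,\beta)$-winning set of $\mathbb{R}$.
   Context: For $\delta>0$, $\mathbf{Bad}(\delta)$ denotes the set of irrational real numbers $x$ for which there exists an integer $Q>0$ (depending on $x$) such that $|x-p/q|\ge \delta/q^2$ for all integers $q\ge Q$ and all integers $p$ coprime to $q$. Schmidt game: for a closed ball $B$ (positive radius, radius denoted $\rho(B)$) and $0<\gamma\le 1$, let $B^\gamma$ be the collection of closed balls $\widetilde B\subset B$ with $\rho(\widetilde B)=\gamma\rho(B)$. For $S\subset\mathbb{R}^d$ and $0<\alpha,\beta<1$, in the $(\alpha,\beta;S)$-game Bob chooses an arbitrary closed ball $B_1$, and then, for $n\ge1$, Alice chooses $A_n\in B_n^\alpha$ and Bob chooses $B_{n+1}\in A_n^\beta$. The intersection $\bigcap_{n} B_n$ is a single point. $S$ is an $(\alpha,\beta)$-winning set of $\mathbb{R}^d$ if Alice has a strategy ensuring, whatever Bob plays (including $B_1$), that this point lies in $S$. Here $d=1$ and closed balls are closed bounded intervals of positive length. -}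

module Defs where

open import Data.Integer.Base as ℤ using (ℤ; +_)
import Data.Integer.Coprimality as ℤ
open import Data.List.Base using (List; applyDownFrom)
open import Data.Nat.Base as ℕ using (ℕ; zero; suc)
import Data.Nat.Properties as ℕ
open import Data.Product.Base using (Σ; ∃; _×_; _,_; proj₁; proj₂)
open import Data.Rational.Base as ℚ
  using (ℚ; 0ℚ; 1ℚ; ½; Positive; positive)
open import Data.Rational.Properties as ℚ using (module ≤-Reasoning)
open import Data.Rational.Solver using (module +-*-Solver)
open import Data.Sum.Base using (inj₁; inj₂)
open import Level using (0ℓ)
open import Relation.Binary.PropositionalEquality
  using (_≡_; refl; sym; trans; cong; cong₂; subst)
open import Relation.Nullary.Negation using (¬_)
open import Relation.Unary using (Pred; _∈_; _⊆_)

Eventually : Pred ℕ 0ℓ → Set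
Eventually P = ∃ λ N → ∀ n → N ℕ.≤ n → P n

Cauchy : (ℕ → ℚ) → Set
Cauchy s = ∀ ε → 0ℚ ℚ.< ε →
  ∃ λ N → ∀ m n → N ℕ.≤ m → N ℕ.≤ n → ℚ.∣ s m ℚ.- s n ∣ ℚ.≤ ε

record ℝ : Set where
  constructor mkℝ
  field
    seq    : ℕ → ℚ
    cauchy : Cauchy seq

open ℝ public

infix 4 _≈_ _≤_ _<_

-- A real number is presented by a Cauchy sequence; no quotient is taken,
-- and _≈_ is the equality of real numbers.

_≈_ : ℝ → ℝ → Set
x ≈ y = ∀ ε → 0ℚ ℚ.< ε → Eventually λ n → ℚ.∣ seq x n ℚ.- seq y n ∣ ℚ.≤ ε

_≤_ : ℝ → ℝ → Set
x ≤ y = ∀ ε → 0ℚ ℚ.< ε → Eventually λ n → seq x n ℚ.≤ seq y n ℚ.+ ε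

_<_ : ℝ → ℝ → Set
x < y = ∃ λ ε → 0ℚ ℚ.< ε × Eventually λ n → seq x n ℚ.+ ε ℚ.≤ seq y n

sub-add : ∀ a b → a ≡ (a ℚ.- b) ℚ.+ b
sub-add = solve 2 (λ a b → a := (a :- b) :+ b) refl
  where
  open +-*-Solver

add-sub : ∀ a b → (a ℚ.+ b) ℚ.- b ≡ a
add-sub = solve 2 (λ a b → (a :+ b) :- b := a) refl
  where
  open +-*-Solver

neg-sub : ∀ a b → ℚ.- (a ℚ.- b) ≡ b ℚ.- a
neg-sub = solve 2 (λ a b → :- (a :- b) := b :- a) refl
  where
  open +-*-Solver

sub-neg : ∀ a b → ℚ.- (a ℚ.- b) ≡ (ℚ.- a) ℚ.- (ℚ.- b)
sub-neg = solve 2 (λ a b → :- (a :- b) := (:- a) :- (:- b)) refl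
  where
  open +-*-Solver

+-interchange : ∀ a b c d →
  (a ℚ.+ b) ℚ.- (c ℚ.+ d) ≡ (a ℚ.- c) ℚ.+ (b ℚ.- d)
+-interchange = solve 4 (λ a b c d →
  (a :+ b) :- (c :+ d) := (a :- c) :+ (b :- d)) refl
  where
  open +-*-Solver

*-interchange : ∀ a b c d →
  a ℚ.* b ℚ.- c ℚ.* d ≡ a ℚ.* (b ℚ.- d) ℚ.+ d ℚ.* (a ℚ.- c)
*-interchange = solve 4 (λ a b c d →
  a :* b :- c :* d := a :* (b :- d) :+ d :* (a :- c)) refl
  where
  open +-*-Solver

½-pos : ∀ {ε} → 0ℚ ℚ.< ε → 0ℚ ℚ.< ½ ℚ.* ε
½-pos {ε} 0<ε = ℚ.positive⁻¹ (½ ℚ.* ε)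
  {{ℚ.pos*pos⇒pos ½ ε {{positive 0<ε}}}}

½+½ : ∀ ε → ½ ℚ.* ε ℚ.+ ½ ℚ.* ε ≡ ε
½+½ ε = trans (sym (ℚ.*-distribʳ-+ ε ½ ½)) (ℚ.*-identityˡ ε)

⊔-l : ∀ {M N n} → M ℕ.⊔ N ℕ.≤ n → M ℕ.≤ n
⊔-l {M} {N} = ℕ.m⊔n≤o⇒m≤o M N

⊔-r : ∀ {M N n} → M ℕ.⊔ N ℕ.≤ n → N ℕ.≤ n
⊔-r {M} {N} = ℕ.m⊔n≤o⇒n≤o M N

∣a∣-∣b∣≤∣a-b∣ : ∀ a b → ℚ.∣ a ∣ ℚ.- ℚ.∣ b ∣ ℚ.≤ ℚ.∣ a ℚ.- b ∣
∣a∣-∣b∣≤∣a-b∣ a b = begin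
  ℚ.∣ a ∣ ℚ.- ℚ.∣ b ∣
    ≡⟨ cong (λ c → ℚ.∣ c ∣ ℚ.- ℚ.∣ b ∣) (sub-add a b) ⟩
  ℚ.∣ (a ℚ.- b) ℚ.+ b ∣ ℚ.- ℚ.∣ b ∣
    ≤⟨ ℚ.+-monoˡ-≤ (ℚ.- ℚ.∣ b ∣) (ℚ.∣p+q∣≤∣p∣+∣q∣ (a ℚ.- b) b) ⟩
  (ℚ.∣ a ℚ.- b ∣ ℚ.+ ℚ.∣ b ∣) ℚ.- ℚ.∣ b ∣
    ≡⟨ add-sub ℚ.∣ a ℚ.- b ∣ ℚ.∣ b ∣ ⟩
  ℚ.∣ a ℚ.- b ∣ ∎
  where
  open ≤-Reasoning

∣-∣-swap : ∀ a b → ℚ.∣ a ℚ.- b ∣ ≡ ℚ.∣ b ℚ.- a ∣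
∣-∣-swap a b = trans (sym (ℚ.∣-p∣≡∣p∣ (a ℚ.- b)))
  (cong ℚ.∣_∣ (neg-sub a b))

∣∣a∣-∣b∣∣≤∣a-b∣ : ∀ a b → ℚ.∣ ℚ.∣ a ∣ ℚ.- ℚ.∣ b ∣ ∣ ℚ.≤ ℚ.∣ a ℚ.- b ∣
∣∣a∣-∣b∣∣≤∣a-b∣ a b with ℚ.∣p∣≡p∨∣p∣≡-p (ℚ.∣ a ∣ ℚ.- ℚ.∣ b ∣)
... | inj₁ eq = ℚ.≤-trans (ℚ.≤-reflexive eq) (∣a∣-∣b∣≤∣a-b∣ a b)
... | inj₂ eq = begin
  ℚ.∣ ℚ.∣ a ∣ ℚ.- ℚ.∣ b ∣ ∣  ≡⟨ eq ⟩
  ℚ.- (ℚ.∣ a ∣ ℚ.- ℚ.∣ b ∣)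
    ≡⟨ neg-sub ℚ.∣ a ∣ ℚ.∣ b ∣ ⟩
  ℚ.∣ b ∣ ℚ.- ℚ.∣ a ∣        ≤⟨ ∣a∣-∣b∣≤∣a-b∣ b a ⟩
  ℚ.∣ b ℚ.- a ∣              ≡⟨ ∣-∣-swap b a ⟩
  ℚ.∣ a ℚ.- b ∣              ∎
  where
  open ≤-Reasoning

const-cauchy : ∀ r → Cauchy (λ _ → r)
const-cauchy r ε 0<ε = 0 , λ _ _ _ _ →
  subst (λ d → ℚ.∣ d ∣ ℚ.≤ ε) (sym (ℚ.+-inverseʳ r)) (ℚ.<⇒≤ 0<ε)

neg-cauchy : ∀ s → Cauchy s → Cauchy (λ n → ℚ.- s n)
neg-cauchy s cs ε 0<ε with cs ε 0<ε
... | N , h = N , λ m n N≤m N≤n →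
  subst (ℚ._≤ ε) (eq (s m) (s n)) (h m n N≤m N≤n)
  where
  eq : ∀ a b → ℚ.∣ a ℚ.- b ∣ ≡ ℚ.∣ (ℚ.- a) ℚ.- (ℚ.- b) ∣
  eq a b = trans (sym (ℚ.∣-p∣≡∣p∣ (a ℚ.- b)))
    (cong ℚ.∣_∣ (sub-neg a b))

abs-cauchy : ∀ s → Cauchy s → Cauchy (λ n → ℚ.∣ s n ∣)
abs-cauchy s cs ε 0<ε with cs ε 0<ε
... | N , h = N , λ m n N≤m N≤n →
  ℚ.≤-trans (∣∣a∣-∣b∣∣≤∣a-b∣ (s m) (s n)) (h m n N≤m N≤n)

+-cauchy : ∀ s t → Cauchy s → Cauchy t → Cauchy (λ n → s n ℚ.+ t n)
+-cauchy s t cs ct ε 0<ε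
  with cs (½ ℚ.* ε) (½-pos 0<ε) | ct (½ ℚ.* ε) (½-pos 0<ε)
... | M , h | N , k = M ℕ.⊔ N , λ m n p q → begin
  ℚ.∣ (s m ℚ.+ t m) ℚ.- (s n ℚ.+ t n) ∣
    ≡⟨ cong ℚ.∣_∣ (+-interchange (s m) (t m) (s n) (t n)) ⟩
  ℚ.∣ (s m ℚ.- s n) ℚ.+ (t m ℚ.- t n) ∣
    ≤⟨ ℚ.∣p+q∣≤∣p∣+∣q∣ (s m ℚ.- s n) (t m ℚ.- t n) ⟩
  ℚ.∣ s m ℚ.- s n ∣ ℚ.+ ℚ.∣ t m ℚ.- t n ∣
    ≤⟨ ℚ.+-mono-≤ (h m n (⊔-l p) (⊔-l q)) (k m n (⊔-r {M} p) (⊔-r {M} q)) ⟩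
  ½ ℚ.* ε ℚ.+ ½ ℚ.* ε  ≡⟨ ½+½ ε ⟩
  ε ∎
  where
  open ≤-Reasoning

bound : ∀ {s} → Cauchy s →
  ∃ λ K → Positive K × Eventually λ n → ℚ.∣ s n ∣ ℚ.≤ K
bound {s} cs with cs 1ℚ (ℚ.positive⁻¹ 1ℚ)
... | N , h = 1ℚ ℚ.+ ℚ.∣ s N ∣
            , ℚ.pos+nonNeg⇒pos 1ℚ ℚ.∣ s N ∣ {{ℚ.∣-∣-nonNeg (s N)}}
            , N , λ n N≤n → begin
  ℚ.∣ s n ∣
    ≡⟨ cong ℚ.∣_∣ (sub-add (s n) (s N)) ⟩
  ℚ.∣ (s n ℚ.- s N) ℚ.+ s N ∣
    ≤⟨ ℚ.∣p+q∣≤∣p∣+∣q∣ (s n ℚ.- s N) (s N) ⟩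
  ℚ.∣ s n ℚ.- s N ∣ ℚ.+ ℚ.∣ s N ∣
    ≤⟨ ℚ.+-monoˡ-≤ ℚ.∣ s N ∣ (h n N N≤n ℕ.≤-refl) ⟩
  1ℚ ℚ.+ ℚ.∣ s N ∣ ∎
  where
  open ≤-Reasoning

-- For K > 0, a tolerance η > 0 with K * η = ε / 2.
shrink : ∀ K → Positive K → ∀ {ε} → 0ℚ ℚ.< ε →
  ∃ λ η → 0ℚ ℚ.< η × K ℚ.* η ≡ ½ ℚ.* ε
shrink K K>0 {ε} 0<ε = K⁻¹ ℚ.* (½ ℚ.* ε)
  , ℚ.positive⁻¹ (K⁻¹ ℚ.* (½ ℚ.* ε))
      {{ℚ.pos*pos⇒pos K⁻¹ {{ℚ.1/pos⇒pos K}} (½ ℚ.* ε) {{positive (½-pos 0<ε)}}}}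
  , trans (sym (ℚ.*-assoc K K⁻¹ (½ ℚ.* ε)))
      (trans (cong (ℚ._* (½ ℚ.* ε)) (ℚ.*-inverseʳ K))
             (ℚ.*-identityˡ (½ ℚ.* ε)))
  where
  instance
    posK : Positive K
    posK = K>0
    nzK : ℚ.NonZero K
    nzK = ℚ.pos⇒nonZero K
  K⁻¹ : ℚ
  K⁻¹ = ℚ.1/ K

∣*∣-bound : ∀ a b K η → Positive K → ℚ.∣ a ∣ ℚ.≤ K → ℚ.∣ b ∣ ℚ.≤ η →
  ℚ.∣ a ℚ.* b ∣ ℚ.≤ K ℚ.* η
∣*∣-bound a b K η K>0 a≤K b≤η = begin
  ℚ.∣ a ℚ.* b ∣          ≡⟨ ℚ.∣p*q∣≡∣p∣*∣q∣ a b ⟩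
  ℚ.∣ a ∣ ℚ.* ℚ.∣ b ∣
    ≤⟨ ℚ.*-monoʳ-≤-nonNeg ℚ.∣ b ∣ {{ℚ.∣-∣-nonNeg b}} a≤K ⟩
  K ℚ.* ℚ.∣ b ∣
    ≤⟨ ℚ.*-monoˡ-≤-nonNeg K {{K≥0}} b≤η ⟩
  K ℚ.* η ∎
  where
  open ≤-Reasoning
  K≥0 : ℚ.NonNegative K
  K≥0 = ℚ.pos⇒nonNeg K {{K>0}}

*-close : ∀ a b c d K L {η θ} → Positive K → Positive L →
  ℚ.∣ a ∣ ℚ.≤ K → ℚ.∣ b ℚ.- d ∣ ℚ.≤ θ →
  ℚ.∣ d ∣ ℚ.≤ L → ℚ.∣ a ℚ.- c ∣ ℚ.≤ η →
  ℚ.∣ a ℚ.* b ℚ.- c ℚ.* d ∣ ℚ.≤ K ℚ.* θ ℚ.+ L ℚ.* η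
*-close a b c d K L {η} {θ} K>0 L>0 a≤K b-d≤θ d≤L a-c≤η = begin
  ℚ.∣ a ℚ.* b ℚ.- c ℚ.* d ∣
    ≡⟨ cong ℚ.∣_∣ (*-interchange a b c d) ⟩
  ℚ.∣ a ℚ.* (b ℚ.- d) ℚ.+ d ℚ.* (a ℚ.- c) ∣
    ≤⟨ ℚ.∣p+q∣≤∣p∣+∣q∣ (a ℚ.* (b ℚ.- d)) (d ℚ.* (a ℚ.- c)) ⟩
  ℚ.∣ a ℚ.* (b ℚ.- d) ∣ ℚ.+ ℚ.∣ d ℚ.* (a ℚ.- c) ∣
    ≤⟨ ℚ.+-mono-≤ (∣*∣-bound a (b ℚ.- d) K θ K>0 a≤K b-d≤θ)
                   (∣*∣-bound d (a ℚ.- c) L η L>0 d≤L a-c≤η) ⟩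
  K ℚ.* θ ℚ.+ L ℚ.* η ∎
  where
  open ≤-Reasoning

*-cauchy : ∀ s t → Cauchy s → Cauchy t → Cauchy (λ n → s n ℚ.* t n)
*-cauchy s t cs ct ε 0<ε = choose (bound cs) (bound ct)
  where
  Goal : Set
  Goal = ∃ λ N → ∀ m n → N ℕ.≤ m → N ℕ.≤ n →
    ℚ.∣ s m ℚ.* t m ℚ.- s n ℚ.* t n ∣ ℚ.≤ ε

  Bounded : (ℕ → ℚ) → ℚ → Set
  Bounded u K = Eventually λ n → ℚ.∣ u n ∣ ℚ.≤ K

  Close : (ℕ → ℚ) → ℚ → Set
  Close u η = ∃ λ N → ∀ m n → N ℕ.≤ m → N ℕ.≤ n → ℚ.∣ u m ℚ.- u n ∣ ℚ.≤ η

  finish : ∀ K L η θ → Positive K → Positive L →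
    K ℚ.* θ ≡ ½ ℚ.* ε → L ℚ.* η ≡ ½ ℚ.* ε →
    Bounded s K → Bounded t L → Close s η → Close t θ → Goal
  finish K L η θ K>0 L>0 Kθ Lη (M₁ , bs) (M₂ , bt) (N₁ , h) (N₂ , k) =
    M ℕ.⊔ N , λ m n p q → ℚ.≤-trans
      (*-close (s m) (t m) (s n) (t n) K L {η} {θ} K>0 L>0
        (bs m (⊔-l {M₁} {M₂} (⊔-l {M} {N} p)))
        (k m n (⊔-r {N₁} {N₂} (⊔-r {M} {N} p)) (⊔-r {N₁} {N₂} (⊔-r {M} {N} q)))
        (bt n (⊔-r {M₁} {M₂} (⊔-l {M} {N} q)))
        (h m n (⊔-l {N₁} {N₂} (⊔-r {M} {N} p)) (⊔-l {N₁} {N₂} (⊔-r {M} {N} q))))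
      (ℚ.≤-reflexive (trans (cong₂ ℚ._+_ Kθ Lη) (½+½ ε)))
    where
    M N : ℕ
    M = M₁ ℕ.⊔ M₂
    N = N₁ ℕ.⊔ N₂

  choose : (∃ λ K → Positive K × Bounded s K) →
    (∃ λ L → Positive L × Bounded t L) → Goal
  choose (K , K>0 , bs) (L , L>0 , bt) =
    tolerances (shrink L L>0 0<ε) (shrink K K>0 0<ε)
    where
    tolerances : (∃ λ η → 0ℚ ℚ.< η × L ℚ.* η ≡ ½ ℚ.* ε) →
      (∃ λ θ → 0ℚ ℚ.< θ × K ℚ.* θ ≡ ½ ℚ.* ε) → Goal
    tolerances (η , 0<η , Lη) (θ , 0<θ , Kθ) =
      finish K L η θ K>0 L>0 Kθ Lη bs bt (cs η 0<η) (ct θ 0<θ)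

infixl 7 _*_ _÷_
infixl 6 _+_ _-_
infix  8 -_

fromℚ : ℚ → ℝ
fromℚ r = mkℝ (λ _ → r) (const-cauchy r)

0ℝ 1ℝ : ℝ
0ℝ = fromℚ 0ℚ
1ℝ = fromℚ 1ℚ

_+_ : ℝ → ℝ → ℝ
x + y = mkℝ (λ n → seq x n ℚ.+ seq y n) (+-cauchy (seq x) (seq y) (cauchy x) (cauchy y))

-_ : ℝ → ℝ
- x = mkℝ (λ n → ℚ.- seq x n) (neg-cauchy (seq x) (cauchy x))

_-_ : ℝ → ℝ → ℝ
x - y = x + (- y)

_*_ : ℝ → ℝ → ℝ
x * y = mkℝ (λ n → seq x n ℚ.* seq y n) (*-cauchy (seq x) (seq y) (cauchy x) (cauchy y))

∣_∣ : ℝ → ℝ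
∣ x ∣ = mkℝ (λ n → ℚ.∣ seq x n ∣) (abs-cauchy (seq x) (cauchy x))

_÷_ : ℝ → (k : ℕ) .{{_ : ℕ.NonZero k}} → ℝ
x ÷ k = x * fromℚ ((+ 1) ℚ./ k)

Irrational : Pred ℝ 0ℓ
Irrational x = ∀ (r : ℚ) → ¬ (x ≈ fromℚ r)

-- Denominators q ≥ Q > 0 are positive, so they range over the nonzero naturals.

Bad : ℝ → Pred ℝ 0ℓ
Bad δ x = Irrational x ×
  (∃ λ (Q : ℕ) → 0 ℕ.< Q ×
    (∀ (q : ℕ) .{{_ : ℕ.NonZero q}} → Q ℕ.≤ q →
     ∀ (p : ℤ) → ℤ.Coprime p (+ q) →
     (δ ÷ (q ℕ.^ 2)) {{ℕ.m^n≢0 q 2}} ≤ ∣ x - fromℚ (p ℚ./ q) ∣))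

record Ball : Set where
  constructor mkBall
  field
    centre   : ℝ
    radius   : ℝ
    radius>0 : 0ℝ < radius

open Ball public

⟦_⟧ : Ball → Pred ℝ 0ℓ
⟦ B ⟧ x = ∣ x - centre B ∣ ≤ radius B

infixr 8 _^_

_^_ : Ball → ℝ → Pred Ball 0ℓ
(B ^ γ) B̃ = ⟦ B̃ ⟧ ⊆ ⟦ B ⟧ × radius B̃ ≈ γ * radius B

-- Alice's answer to Bob's ball b, given his earlier balls (latest first).
-- Her own earlier balls need not be recorded, being determined by these.  The
-- answer may depend on the Cauchy sequences that present Bob's balls.

Strategy : ℝ → Set
Strategy α = (earlier : List Ball) (b : Ball) → Σ Ball (_∈ b ^ α)

-- Bob's balls B₁, B₂, … are B 0, B 1, …, and Alice's A₁, A₂, … likewise.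

alice : (α : ℝ) → Strategy α → (ℕ → Ball) → ℕ → Ball
alice α σ B n = proj₁ (σ (applyDownFrom B n) (B n))

Legal : (α β : ℝ) → Strategy α → (ℕ → Ball) → Set
Legal α β σ B = ∀ n → B (suc n) ∈ alice α σ B n ^ β

-- The balls of a play shrink to a single real number; Alice wins when it lies
-- in S, i.e. when every point common to all of them does.

Winning : (α β : ℝ) → Pred ℝ 0ℓ → Set
Winning α β S = ∃ λ (σ : Strategy α) →
  ∀ (B : ℕ → Ball) → Legal α β σ B →
  ∀ (x : ℝ) → (∀ n → x ∈ ⟦ B n ⟧) → x ∈ S

module Submission where

-- Alice plays positionally.  At a ball of radius ρ she considers the rationals p/q with
-- q² < 5/(9ρ), up to small errors.  Two of them differ by at least 1/(qq'), hence at most one of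
-- them can come close to the middle third of the ball.  If there is none, she plays in the
-- middle; if there is one, she plays at the end of the ball on the other side of the centre, and
-- the separation keeps all the other relevant rationals away from there.  In this way her ball
-- stays at distance min(1/(17q²), 31ρ/100) from every relevant rational.
-- Each rational becomes relevant, since the radii shrink to 0, which gives irrationality.  If it
-- becomes relevant at stage n + 1 but not at stage n, then 1/q² ≤ 9ρₙ/5, while ρₙ₊₁ = αβρₙ, so
-- that αβ/(6q²) ≤ 3ρₙ₊₁/10; and αβ/(6q²) ≤ 1/(18q²) always.
-- All inequalities have slack, so Alice can decide with rational approximations to the centre
-- and the radius of the ball.

module Rationals where

  open import Defs using (neg-sub)
  open import Data.Integer.Base as ℤ using (ℤ; +_; -[1+_])
  import Data.Integer.Properties as ℤ
  open import Data.List.Base using (_∷_; [])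
  open import Data.Nat.Base as ℕ using (ℕ; zero; suc)
  import Data.Nat.Properties as ℕ
  open import Data.Product.Base using (∃; ∃₂; _×_; _,_; proj₁; proj₂)
  open import Data.Rational.Base
  open import Data.Rational.Properties as ℚ
  open import Data.Rational.Unnormalised.Base as ℚᵘ using (mkℚᵘ; *≡*; *≤*)
  import Data.Rational.Unnormalised.Properties as ℚᵘ
  open import Data.Sum.Base using (_⊎_; inj₁; inj₂)
  open import Relation.Binary.PropositionalEquality
  open import Relation.Nullary.Decidable
    using (Dec; yes; no; dec⇒maybe; from-no; map′; _×-dec_; _⊎-dec_)
  open import Relation.Nullary.Negation using (¬_; contradiction)
  open import Tactic.RingSolver
  open import Tactic.RingSolver.Core.AlmostCommutativeRing

  -- Inequalities of rationals from explicit certificates.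

  ring : AlmostCommutativeRing _ _
  ring = fromCommutativeRing +-*-commutativeRing (λ x → dec⇒maybe (0ℚ ℚ.≟ x))

  infixr 5 _⊕_
  infixr 6 _⊙_ _⊛_

  diff : ∀ {a b} → a ≤ b → 0ℚ ≤ b - a
  diff {a} {b} a≤b = subst (_≤ b - a) (+-inverseʳ a) (+-monoˡ-≤ (- a) a≤b)

  _⊕_ : ∀ {a b} → 0ℚ ≤ a → 0ℚ ≤ b → 0ℚ ≤ a + b
  _⊕_ = +-mono-≤

  _⊛_ : ∀ {a b} → 0ℚ ≤ a → 0ℚ ≤ b → 0ℚ ≤ a * b
  _⊛_ {a} {b} 0≤a 0≤b = subst (_≤ a * b) (*-zeroˡ b)
    (*-monoʳ-≤-nonNeg b {{nonNegative 0≤b}} 0≤a)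

  _⊙_ : ∀ k .{{_ : NonNegative k}} {a} → 0ℚ ≤ a → 0ℚ ≤ k * a
  k ⊙ 0≤a = nonNegative⁻¹ k ⊛ 0≤a

  -- A linear-arithmetic certificate: a ≤ b because b - a is an explicit nonnegative
  -- combination e of the hypotheses.
  because : ∀ {a b e} → 0ℚ ≤ e → e ≡ b - a → a ≤ b
  because {a} {b} 0≤e refl = subst₂ _≤_ (+-identityʳ a) eq (+-monoʳ-≤ a 0≤e)
    where
    eq : a + (b - a) ≡ b
    eq = solve (a ∷ b ∷ []) ring

  *-pos : ∀ {a b} → 0ℚ < a → 0ℚ < b → 0ℚ < a * b
  *-pos {a} {b} 0<a 0<b =
    positive⁻¹ (a * b) {{pos*pos⇒pos a {{positive 0<a}} b {{positive 0<b}}}}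

  p≤∣p∣ : ∀ p → p ≤ ∣ p ∣
  p≤∣p∣ p with ≤-total 0ℚ p
  ... | inj₁ 0≤p = ≤-reflexive (sym (0≤p⇒∣p∣≡p 0≤p))
  ... | inj₂ p≤0 = ≤-trans p≤0 (0≤∣p∣ p)

  -p≤∣p∣ : ∀ p → - p ≤ ∣ p ∣
  -p≤∣p∣ p = subst (- p ≤_) (∣-p∣≡∣p∣ p) (p≤∣p∣ (- p))

  ∣p∣≤q : ∀ {p q} → p ≤ q → - p ≤ q → ∣ p ∣ ≤ q
  ∣p∣≤q {p} {q} p≤q -p≤q with ∣p∣≡p∨∣p∣≡-p p
  ... | inj₁ eq = subst (_≤ q) (sym eq) p≤q
  ... | inj₂ eq = subst (_≤ q) (sym eq) -p≤q

  -- Fractions as integers times reciprocals.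

  fromℚᵘ-+ : ∀ a b → fromℚᵘ a + fromℚᵘ b ≡ fromℚᵘ (a ℚᵘ.+ b)
  fromℚᵘ-+ a b = toℚᵘ-injective (begin-equality
    toℚᵘ (fromℚᵘ a + fromℚᵘ b)             ≃⟨ toℚᵘ-homo-+ (fromℚᵘ a) (fromℚᵘ b) ⟩
    toℚᵘ (fromℚᵘ a) ℚᵘ.+ toℚᵘ (fromℚᵘ b)   ≃⟨ ℚᵘ.+-cong (toℚᵘ-fromℚᵘ a) (toℚᵘ-fromℚᵘ b) ⟩
    a ℚᵘ.+ b                               ≃⟨ toℚᵘ-fromℚᵘ (a ℚᵘ.+ b) ⟨
    toℚᵘ (fromℚᵘ (a ℚᵘ.+ b))               ∎)
    where open ℚᵘ.≤-Reasoning

  fromℚᵘ-* : ∀ a b → fromℚᵘ a * fromℚᵘ b ≡ fromℚᵘ (a ℚᵘ.* b)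
  fromℚᵘ-* a b = toℚᵘ-injective (begin-equality
    toℚᵘ (fromℚᵘ a * fromℚᵘ b)             ≃⟨ toℚᵘ-homo-* (fromℚᵘ a) (fromℚᵘ b) ⟩
    toℚᵘ (fromℚᵘ a) ℚᵘ.* toℚᵘ (fromℚᵘ b)   ≃⟨ ℚᵘ.*-cong (toℚᵘ-fromℚᵘ a) (toℚᵘ-fromℚᵘ b) ⟩
    a ℚᵘ.* b                               ≃⟨ toℚᵘ-fromℚᵘ (a ℚᵘ.* b) ⟨
    toℚᵘ (fromℚᵘ (a ℚᵘ.* b))               ∎)
    where open ℚᵘ.≤-Reasoning

  fromℚᵘ-neg : ∀ a → - fromℚᵘ a ≡ fromℚᵘ (ℚᵘ.- a)
  fromℚᵘ-neg a = toℚᵘ-injective (begin-equality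
    toℚᵘ (- fromℚᵘ a)         ≃⟨ toℚᵘ-homo‿- (fromℚᵘ a) ⟩
    ℚᵘ.- toℚᵘ (fromℚᵘ a)      ≃⟨ ℚᵘ.-‿cong (toℚᵘ-fromℚᵘ a) ⟩
    ℚᵘ.- a                    ≃⟨ toℚᵘ-fromℚᵘ (ℚᵘ.- a) ⟨
    toℚᵘ (fromℚᵘ (ℚᵘ.- a))    ∎)
    where open ℚᵘ.≤-Reasoning

  fromℚᵘ-mono-≤ : ∀ {a b} → a ℚᵘ.≤ b → fromℚᵘ a ≤ fromℚᵘ b
  fromℚᵘ-mono-≤ {a} {b} a≤b = toℚᵘ-cancel-≤ (begin
    toℚᵘ (fromℚᵘ a)  ≃⟨ toℚᵘ-fromℚᵘ a ⟩
    a                ≤⟨ a≤b ⟩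
    b                ≃⟨ toℚᵘ-fromℚᵘ b ⟨
    toℚᵘ (fromℚᵘ b)  ∎)
    where open ℚᵘ.≤-Reasoning

  fromℚᵘ-cancel-≤ : ∀ {a b} → fromℚᵘ a ≤ fromℚᵘ b → a ℚᵘ.≤ b
  fromℚᵘ-cancel-≤ {a} {b} a≤b = begin
    a                ≃⟨ toℚᵘ-fromℚᵘ a ⟨
    toℚᵘ (fromℚᵘ a)  ≤⟨ toℚᵘ-mono-≤ a≤b ⟩
    toℚᵘ (fromℚᵘ b)  ≃⟨ toℚᵘ-fromℚᵘ b ⟩
    b                ∎
    where open ℚᵘ.≤-Reasoning

  /1-mono-≤ : ∀ {i j} → i ℤ.≤ j → i / 1 ≤ j / 1
  /1-mono-≤ {i} {j} i≤j = fromℚᵘ-mono-≤ {mkℚᵘ i 0} {mkℚᵘ j 0}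
    (*≤* (ℤ.*-monoʳ-≤-nonNeg (+ 1) i≤j))

  /1-cancel-≤ : ∀ {i j} → i / 1 ≤ j / 1 → i ℤ.≤ j
  /1-cancel-≤ {i} {j} i≤j with fromℚᵘ-cancel-≤ {mkℚᵘ i 0} {mkℚᵘ j 0} i≤j
  ... | *≤* h = subst₂ ℤ._≤_ (ℤ.*-identityʳ i) (ℤ.*-identityʳ j) h

  archimedean : ∀ a → ∃ λ N → a ≤ + N / 1
  archimedean a@(mkℚ n d _) = ℤ.∣ n ∣ , subst (_≤ + ℤ.∣ n ∣ / 1) (fromℚᵘ-toℚᵘ a)
    (fromℚᵘ-mono-≤ {toℚᵘ a} {mkℚᵘ (+ ℤ.∣ n ∣) 0} (*≤* (n≤ n)))
    where
    n≤ : ∀ n → n ℤ.* + 1 ℤ.≤ + ℤ.∣ n ∣ ℤ.* + suc d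
    n≤ n = ℤ.≤-trans (ℤ.≤-trans (ℤ.≤-reflexive (ℤ.*-identityʳ n)) (h n))
      (subst (+ ℤ.∣ n ∣ ℤ.≤_) (ℤ.pos-* ℤ.∣ n ∣ (suc d))
        (ℤ.+≤+ (ℕ.m≤m*n ℤ.∣ n ∣ (suc d))))
      where
      h : ∀ n → n ℤ.≤ + ℤ.∣ n ∣
      h (+ _)      = ℤ.≤-refl
      h (-[1+ _ ]) = ℤ.-≤+

  -- Denominators are written `suc j`, which makes them nonzero by construction.
  recip : ℕ → ℚ
  recip j = + 1 / suc j

  /1-*-recip : ∀ p j → p / 1 * recip j ≡ p / suc j
  /1-*-recip p j = trans (fromℚᵘ-* (mkℚᵘ p 0) (mkℚᵘ (+ 1) j))
    (fromℚᵘ-cong {mkℚᵘ p 0 ℚᵘ.* mkℚᵘ (+ 1) j} {mkℚᵘ p j}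
      (*≡* (cong₂ ℤ._*_ (ℤ.*-identityʳ p)
        (cong +_ (sym (ℕ.+-identityʳ (suc j)))))))

  suc/1*recip≡1 : ∀ j → + suc j / 1 * recip j ≡ 1ℚ
  suc/1*recip≡1 j = trans (/1-*-recip (+ suc j) j)
    (fromℚᵘ-cong {mkℚᵘ (+ suc j) j} {mkℚᵘ (+ 1) 0}
      (*≡* (ℤ.*-comm (+ suc j) (+ 1))))

  recip*recip : ∀ j → recip j * recip j ≡ (+ 1 / (suc j ℕ.^ 2)) {{ℕ.m^n≢0 (suc j) 2}}
  recip*recip j = trans (fromℚᵘ-* (mkℚᵘ (+ 1) j) (mkℚᵘ (+ 1) j))
    (/-cong {+ 1} refl (cong (suc j ℕ.*_) (sym (ℕ.*-identityʳ (suc j)))))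

  0<recip : ∀ j → 0ℚ < recip j
  0<recip j = positive⁻¹ (recip j) {{normalize-pos 1 (suc j)}}

  recip≤1 : ∀ j → recip j ≤ 1ℚ
  recip≤1 j = fromℚᵘ-mono-≤ {mkℚᵘ (+ 1) j} {mkℚᵘ (+ 1) 0} (*≤* (ℤ.+≤+ (ℕ.s≤s ℕ.z≤n)))

  -- Separation of distinct fractions.

  ≡-from-difference : ∀ u v δ → u - v ≡ 0ℚ * δ → u ≡ v
  ≡-from-difference u v δ eq = ≤-antisym
    (because (diff (≤-reflexive eq)) (solve (u ∷ v ∷ δ ∷ []) ring))
    (because (diff (≤-reflexive (sym eq))) (solve (u ∷ v ∷ δ ∷ []) ring))

  ≥-from-difference : ∀ u v δ k → 0ℚ ≤ δ → 1ℚ ≤ k → u - v ≡ k * δ → v + δ ≤ u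
  ≥-from-difference u v δ k 0≤δ 1≤k eq = because
    (diff 1≤k ⊛ 0≤δ ⊕ diff (≤-reflexive (sym eq)))
    (solve (u ∷ v ∷ δ ∷ k ∷ []) ring)

  ≤-from-difference : ∀ u v δ k → 0ℚ ≤ δ → k ≤ - 1ℚ → u - v ≡ k * δ → u + δ ≤ v
  ≤-from-difference u v δ k 0≤δ k≤-1 eq = because
    (diff k≤-1 ⊛ 0≤δ ⊕ diff (≤-reflexive eq))
    (solve (u ∷ v ∷ δ ∷ k ∷ []) ring)

  -- The difference `u - v` is an integer multiple of `δ`, and a nonzero integer is at least 1 in
  -- absolute value.
  separation : ∀ p i q j → let u = p / suc i; v = q / suc j; δ = recip i * recip j in
    u ≡ v ⊎ u + δ ≤ v ⊎ v + δ ≤ u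
  separation p i q j = by-sign N refl
    where
    u v δ : ℚ
    u = p / suc i
    v = q / suc j
    δ = recip i * recip j
    N : ℤ
    N = p ℤ.* + suc j ℤ.+ (ℤ.- q) ℤ.* + suc i

    0≤δ : 0ℚ ≤ δ
    0≤δ = <⇒≤ (0<recip i) ⊛ <⇒≤ (0<recip j)

    difference : u - v ≡ N / 1 * δ
    difference = begin
      u - v ≡⟨ cong (λ w → u + w) (fromℚᵘ-neg (mkℚᵘ q j)) ⟩
      u + fromℚᵘ (mkℚᵘ (ℤ.- q) j) ≡⟨ fromℚᵘ-+ (mkℚᵘ p i) (mkℚᵘ (ℤ.- q) j) ⟩
      N / (suc i ℕ.* suc j) ≡⟨ /1-*-recip N _ ⟨
      N / 1 * (+ 1 / (suc i ℕ.* suc j)) ≡⟨ cong (N / 1 *_) (fromℚᵘ-* (mkℚᵘ (+ 1) i) (mkℚᵘ (+ 1) j)) ⟨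
      N / 1 * δ ∎
      where open ≡-Reasoning

    by-sign : ∀ M → M ≡ N → u ≡ v ⊎ u + δ ≤ v ⊎ v + δ ≤ u
    by-sign (+ 0) eq = inj₁ (≡-from-difference u v δ (trans difference (cong (λ n → n / 1 * δ) (sym eq))))
    by-sign (+ suc m) eq = inj₂ (inj₂ (≥-from-difference u v δ (N / 1) 0≤δ
      (/1-mono-≤ (subst (+ 1 ℤ.≤_) eq (ℤ.+≤+ (ℕ.s≤s ℕ.z≤n)))) difference))
    by-sign -[1+ m ] eq = inj₂ (inj₁ (≤-from-difference u v δ (N / 1) 0≤δ
      (/1-mono-≤ (subst (ℤ._≤ -[1+ 0 ]) eq (ℤ.-≤- ℕ.z≤n))) difference))

  -- Zones, relevant rationals and their margins.

  -- Alice's choice for a ball of centre about z and radius about r: she plays at the left end,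
  -- in the middle or at the right end, and her ball then lies in the corresponding zone.  The
  -- zones would be [z - r, z - r/3], [z - r/3, z + r/3] and [z + r/3, z + r] for exact data.
  data Side : Set where
    left middle right : Side

  -- As `-[1+ n ]` denotes -(n + 1), the ends are ±103/100, ±35/100 and ±31/100: the exact ±1 and
  -- ±1/3, moved so that each zone grows and absorbs the approximation errors.
  lower upper : Side → ℚ
  lower left   = -[1+ 102 ] / 100
  lower middle = -[1+ 34 ] / 100
  lower right  = + 31 / 100
  upper left   = -[1+ 30 ] / 100
  upper middle = + 35 / 100
  upper right  = + 103 / 100

  Zone : Side → (z r y : ℚ) → Set
  Zone s z r y = z + lower s * r ≤ y × y ≤ z + upper s * r

  -- X stands for 1 / q: the rationals with denominator q are dealt with once r is below 5/(9q²).
  -- The constant 5/9 must exceed 1/2, so that the margins can stay below r/3, and must be below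
  -- 7/12, so that relevant rationals are far enough apart.
  Relevant : (r X : ℚ) → Set
  Relevant r X = + 9 / 1 * r < + 5 / 1 * (X * X)

  -- The first term exceeds the required αβ/(6q²), since αβ/6 is at most 1/18; the second is the
  -- distance from `z` to the left and right zones.
  margin : (r X : ℚ) → ℚ
  margin r X = (+ 1 / 17 * (X * X)) ⊓ (+ 31 / 100 * r)

  margin≤X²/17 : ∀ r X → margin r X ≤ + 1 / 17 * (X * X)
  margin≤X²/17 r X = p⊓q≤p _ _

  margin≤31r/100 : ∀ r X → margin r X ≤ + 31 / 100 * r
  margin≤31r/100 r X = p⊓q≤q (+ 1 / 17 * (X * X)) _

  margin>0 : ∀ {r X} → 0ℚ < r → 0ℚ < X → 0ℚ < margin r X
  margin>0 {r} {X} 0<r 0<X with ⊓-sel (+ 1 / 17 * (X * X)) (+ 31 / 100 * r)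
  ... | inj₁ eq = subst (0ℚ <_) (sym eq) (*-pos (positive⁻¹ (+ 1 / 17)) (*-pos 0<X 0<X))
  ... | inj₂ eq = subst (0ℚ <_) (sym eq) (*-pos (positive⁻¹ (+ 31 / 100)) 0<r)

  -- With Y ≤ X one has X * Y ≥ Y², which absorbs the margin Y²/17, while the other margin is
  -- bounded by a multiple of r.
  margins-gap : ∀ r X Y d d′ → 0ℚ ≤ r → 0ℚ ≤ Y → Y ≤ X →
    d ≤ + 31 / 100 * r → d′ ≤ + 1 / 17 * (Y * Y) →
    + 9 / 1 * r ≤ + 5 / 1 * (Y * Y) →
    d + d′ + + 138 / 100 * r ≤ X * Y
  margins-gap r X Y d d′ 0≤r 0≤Y Y≤X d≤ d′≤ r≤ = because
    (0≤Y ⊛ diff Y≤X ⊕ diff d′≤ ⊕ diff d≤ ⊕ + 16 / 85 ⊙ diff r≤ ⊕ + 7 / 1700 ⊙ 0≤r)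
    (solve (r ∷ X ∷ Y ∷ d ∷ d′ ∷ []) ring)

  -- The constant 138/100 is 103/100 + 35/100: the far end of a side zone plus the reach of the
  -- middle one. `margins-gap` wants the smaller reciprocal second, so the roles are swapped if
  -- necessary.
  margins-apart : ∀ {r X Y} → 0ℚ ≤ r → 0ℚ ≤ X → 0ℚ ≤ Y →
    Relevant r X → Relevant r Y →
    margin r X + margin r Y + + 138 / 100 * r ≤ X * Y
  margins-apart {r} {X} {Y} 0≤r 0≤X 0≤Y rX rY with ≤-total Y X
  ... | inj₁ Y≤X = margins-gap r X Y (margin r X) (margin r Y) 0≤r 0≤Y Y≤X
          (margin≤31r/100 r X) (margin≤X²/17 r Y) (<⇒≤ rY)
  ... | inj₂ X≤Y = subst₂ _≤_
          (cong (_+ + 138 / 100 * r) (+-comm (margin r Y) (margin r X))) (*-comm Y X)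
          (margins-gap r Y X (margin r Y) (margin r X) 0≤r 0≤X X≤Y
            (margin≤31r/100 r Y) (margin≤X²/17 r X) (<⇒≤ rX))

  -- Distance from a zone to a fraction.

  ≤∣-∣ˡ : ∀ d y v → d ≤ y - v → d ≤ ∣ y - v ∣
  ≤∣-∣ˡ d y v d≤ = ≤-trans d≤ (p≤∣p∣ (y - v))

  ≤∣-∣ʳ : ∀ d y v → d ≤ v - y → d ≤ ∣ y - v ∣
  ≤∣-∣ʳ d y v d≤ = ≤-trans (subst (d ≤_) (sym (neg-sub y v)) d≤) (-p≤∣p∣ (y - v))

  avoid-above : ∀ z r y v d → y ≤ z + upper left * r → z ≤ v → d ≤ + 31 / 100 * r →
    d ≤ ∣ y - v ∣
  avoid-above z r y v d y≤ z≤v d≤ = ≤∣-∣ʳ d y v (because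
    (diff y≤ ⊕ diff z≤v ⊕ diff d≤) (solve (z ∷ r ∷ y ∷ v ∷ d ∷ []) ring))

  avoid-below : ∀ z r y v d → z + lower right * r ≤ y → v ≤ z → d ≤ + 31 / 100 * r →
    d ≤ ∣ y - v ∣
  avoid-below z r y v d ≤y v≤z d≤ = ≤∣-∣ˡ d y v (because
    (diff ≤y ⊕ diff v≤z ⊕ diff d≤) (solve (z ∷ r ∷ y ∷ v ∷ d ∷ []) ring))

  -- The gap `δ` below the hit `u` spends 35r/100 + `d` on the way from `u` down to `z` and 103r/100
  -- on the rest of the left zone, so that `v` still lies `d′` beyond the far end.
  avoid-far-below : ∀ z r y u v d d′ δ → z + lower left * r ≤ y →
    u - z ≤ + 35 / 100 * r + d → v + δ ≤ u → d + d′ + + 138 / 100 * r ≤ δ →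
    d′ ≤ ∣ y - v ∣
  avoid-far-below z r y u v d d′ δ ≤y u≤ vu δ≥ = ≤∣-∣ˡ d′ y v (because
    (diff ≤y ⊕ diff u≤ ⊕ diff vu ⊕ diff δ≥)
    (solve (z ∷ r ∷ y ∷ u ∷ v ∷ d ∷ d′ ∷ δ ∷ []) ring))

  avoid-far-above : ∀ z r y u v d d′ δ → y ≤ z + upper right * r →
    z - u ≤ + 35 / 100 * r + d → u + δ ≤ v → d + d′ + + 138 / 100 * r ≤ δ →
    d′ ≤ ∣ y - v ∣
  avoid-far-above z r y u v d d′ δ y≤ u≥ uv δ≥ = ≤∣-∣ʳ d′ y v (because
    (diff y≤ ⊕ diff u≥ ⊕ diff uv ⊕ diff δ≥)
    (solve (z ∷ r ∷ y ∷ u ∷ v ∷ d ∷ d′ ∷ δ ∷ []) ring))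

  avoid-outside : ∀ z r y v d → Zone middle z r y →
    + 35 / 100 * r + d ≤ ∣ v - z ∣ → d ≤ ∣ y - v ∣
  avoid-outside z r y v d (≤y , y≤) far with ∣p∣≡p∨∣p∣≡-p (v - z)
  ... | inj₁ eq = ≤∣-∣ʳ d y v (because
          (diff y≤ ⊕ diff (subst (+ 35 / 100 * r + d ≤_) eq far))
          (solve (z ∷ r ∷ y ∷ v ∷ d ∷ []) ring))
  ... | inj₂ eq = ≤∣-∣ˡ d y v (because
          (diff ≤y ⊕ diff (subst (+ 35 / 100 * r + d ≤_) eq far))
          (solve (z ∷ r ∷ y ∷ v ∷ d ∷ []) ring))

  drop-summand : ∀ a b c → 0ℚ ≤ b → a + b ≤ c → a ≤ c
  drop-summand a b c 0≤b a+b≤c = because (diff a+b≤c ⊕ 0≤b)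
    (solve (a ∷ b ∷ c ∷ []) ring)

  Avoids : (z r : ℚ) → Side → Set
  Avoids z r s = ∀ p j → Relevant r (recip j) → ∀ y → Zone s z r y →
    margin r (recip j) ≤ ∣ y - p / suc j ∣

  -- A rational whose margin reaches the middle zone.
  Hit : (z r : ℚ) → ℤ → ℕ → Set
  Hit z r p j = Relevant r (recip j) ×
    ∣ p / suc j - z ∣ < + 35 / 100 * r + margin r (recip j)

  hit? : ∀ z r p j → Dec (Hit z r p j)
  hit? z r p j = (_ <? _) ×-dec (_ <? _)

  unhit-middle : ∀ z r → ¬ (∃₂ λ p j → Hit z r p j) → Avoids z r middle
  unhit-middle z r none p j rel y zone = avoid-outside z r y _ _ zone
    (≮⇒≥ (λ near → none (p , j , rel , near)))

  -- A fraction at or above `u` is not below the centre, hence at least 31r/100 away from the left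
  -- zone; one below `u` is separated from `u` so widely that it falls beyond the far end of that
  -- zone.
  hit-above : ∀ z r p i → 0ℚ ≤ r → Hit z r p i → z ≤ p / suc i → Avoids z r left
  hit-above z r p i 0≤r (rel , near) z≤u q j rel′ y (≤y , y≤) =
    by-position (separation p i q j)
    where
    u v : ℚ
    u = p / suc i
    v = q / suc j

    d≤ : margin r (recip j) ≤ + 31 / 100 * r
    d≤ = margin≤31r/100 r (recip j)

    by-position : u ≡ v ⊎ u + recip i * recip j ≤ v ⊎ v + recip i * recip j ≤ u →
      margin r (recip j) ≤ ∣ y - v ∣
    by-position (inj₁ u≡v) = avoid-above z r y v _ y≤ (subst (z ≤_) u≡v z≤u) d≤
    by-position (inj₂ (inj₁ uv)) = avoid-above z r y v _ y≤
      (≤-trans z≤u (drop-summand u _ v 0≤δ uv)) d≤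
      where
      0≤δ : 0ℚ ≤ recip i * recip j
      0≤δ = <⇒≤ (0<recip i) ⊛ <⇒≤ (0<recip j)
    by-position (inj₂ (inj₂ vu)) = avoid-far-below z r y u v _ _ _ ≤y
      (≤-trans (p≤∣p∣ (u - z)) (<⇒≤ near)) vu
      (margins-apart 0≤r (<⇒≤ (0<recip i)) (<⇒≤ (0<recip j)) rel rel′)

  hit-below : ∀ z r p i → 0ℚ ≤ r → Hit z r p i → p / suc i ≤ z → Avoids z r right
  hit-below z r p i 0≤r (rel , near) u≤z q j rel′ y (≤y , y≤) =
    by-position (separation p i q j)
    where
    u v : ℚ
    u = p / suc i
    v = q / suc j

    d≤ : margin r (recip j) ≤ + 31 / 100 * r
    d≤ = margin≤31r/100 r (recip j)

    by-position : u ≡ v ⊎ u + recip i * recip j ≤ v ⊎ v + recip i * recip j ≤ u →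
      margin r (recip j) ≤ ∣ y - v ∣
    by-position (inj₁ u≡v) = avoid-below z r y v _ ≤y (subst (_≤ z) u≡v u≤z) d≤
    by-position (inj₂ (inj₁ uv)) = avoid-far-above z r y u v _ _ _ y≤
      (≤-trans (subst (_≤ ∣ u - z ∣) (neg-sub u z) (-p≤∣p∣ (u - z))) (<⇒≤ near)) uv
      (margins-apart 0≤r (<⇒≤ (0<recip i)) (<⇒≤ (0<recip j)) rel rel′)
    by-position (inj₂ (inj₂ vu)) = avoid-below z r y v _ ≤y
      (≤-trans (drop-summand v _ u 0≤δ vu) u≤z) d≤
      where
      0≤δ : 0ℚ ≤ recip i * recip j
      0≤δ = <⇒≤ (0<recip i) ⊛ <⇒≤ (0<recip j)

  -- Deciding by a finite search whether there is a hit.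

  archimedean-* : ∀ {w} → 0ℚ < w → ∀ a → ∃ λ N → a ≤ w * (+ N / 1)
  archimedean-* {w} 0<w a = scale (archimedean (w⁻¹ * a))
    where
    instance
      w≢0 : NonZero w
      w≢0 = pos⇒nonZero w {{positive 0<w}}

    w⁻¹ : ℚ
    w⁻¹ = 1/ w

    scale : (∃ λ N → w⁻¹ * a ≤ + N / 1) → ∃ λ N → a ≤ w * (+ N / 1)
    scale (N , a/w≤N) = N , subst (_≤ w * (+ N / 1))
      (trans (sym (*-assoc w w⁻¹ a)) (trans (cong (_* a) (*-inverseʳ w)) (*-identityˡ a)))
      (*-monoˡ-≤-nonNeg w {{nonNegative (<⇒≤ 0<w)}} a/w≤N)

  -- The chain is 9 ≤ 9rN ≤ 9rQ ≤ 5QX² ≤ 5QX = 5. The absurdity is an inequality of numerals so that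
  -- a certificate can yield it.
  no-large-denominator : ∀ r X Q N → 0ℚ ≤ r → 0ℚ ≤ X → X ≤ 1ℚ → 0ℚ ≤ Q → Q * X ≡ 1ℚ →
    + 9 / 1 * r ≤ + 5 / 1 * (X * X) → N ≤ Q → 1ℚ ≤ r * N → + 9 / 1 ≤ + 5 / 1
  no-large-denominator r X Q N 0≤r 0≤X X≤1 0≤Q QX≡1 rel N≤Q 1≤rN = because
    (+ 9 / 1 ⊙ diff 1≤rN ⊕ + 9 / 1 ⊙ 0≤r ⊛ diff N≤Q ⊕ 0≤Q ⊛ diff rel
      ⊕ + 5 / 1 ⊙ 0≤X ⊛ 0≤Q ⊛ diff X≤1 ⊕ + 5 / 1 ⊙ diff (≤-reflexive QX≡1))
    (solve (r ∷ X ∷ Q ∷ N ∷ []) ring)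

  0≤n/1 : ∀ n → 0ℚ ≤ + n / 1
  0≤n/1 n = /1-mono-≤ {+ 0} {+ n} (ℤ.+≤+ ℕ.z≤n)

  relevant-denominator : ∀ r N → 0ℚ ≤ r → 1ℚ ≤ r * (+ N / 1) →
    ∀ j → Relevant r (recip j) → j ℕ.< N
  relevant-denominator r N 0≤r 1≤rN j rel with suc j ℕ.≤? N
  ... | yes j<N = j<N
  ... | no  j≮N = contradiction
    (no-large-denominator r (recip j) (+ suc j / 1) (+ N / 1) 0≤r (<⇒≤ (0<recip j))
      (recip≤1 j) (0≤n/1 (suc j)) (suc/1*recip≡1 j) (<⇒≤ rel)
      (/1-mono-≤ {+ N} {+ suc j} (ℤ.+≤+ (ℕ.≤-trans (ℕ.≤-pred (ℕ.≰⇒> j≮N)) (ℕ.n≤1+n j)))) 1≤rN)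
    (from-no (+ 9 / 1 ≤? + 5 / 1))

  numerator-bound : ∀ P X Q N B → P * X ≤ B → Q * X ≡ 1ℚ → 0ℚ ≤ B → 0ℚ ≤ Q → Q ≤ N →
    P ≤ B * N
  numerator-bound P X Q N B PX≤B QX≡1 0≤B 0≤Q Q≤N = subst (_≤ B * N) eq (because
    (0≤Q ⊛ diff PX≤B ⊕ 0≤B ⊛ diff Q≤N) (solve (P ∷ X ∷ Q ∷ N ∷ B ∷ []) ring))
    where
    swap : ∀ P X Q → P * (Q * X) ≡ Q * (P * X)
    swap P X Q = solve (P ∷ X ∷ Q ∷ []) ring
    eq : Q * (P * X) ≡ P
    eq = trans (sym (swap P X Q)) (trans (cong (P *_) QX≡1) (*-identityʳ P))

  -- The constant 66/100 is 35/100 + 31/100, by the cap on the margin.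
  hit-near : ∀ z r p j → Hit z r p j → ∣ p / suc j - z ∣ ≤ + 66 / 100 * r
  hit-near z r p j (_ , near) = ≤-trans (<⇒≤ near)
    (weaken r (margin r (recip j)) (margin≤31r/100 r (recip j)))
    where
    weaken : ∀ r d → d ≤ + 31 / 100 * r → + 35 / 100 * r + d ≤ + 66 / 100 * r
    weaken r d d≤ = because (diff d≤) (solve (r ∷ d ∷ []) ring)

  ∣u∣-bound : ∀ z r u → 0ℚ ≤ r → ∣ u - z ∣ ≤ + 66 / 100 * r → ∣ u ∣ ≤ ∣ z ∣ + r
  ∣u∣-bound z r u 0≤r near = ∣p∣≤q
    (upper-bound z r u ∣ z ∣ 0≤r (p≤∣p∣ z) (≤-trans (p≤∣p∣ (u - z)) near))
    (lower-bound z r u ∣ z ∣ 0≤r (-p≤∣p∣ z) (≤-trans (-p≤∣p∣ (u - z)) near))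
    where
    upper-bound : ∀ z r u a → 0ℚ ≤ r → z ≤ a → u - z ≤ + 66 / 100 * r → u ≤ a + r
    upper-bound z r u a 0≤r z≤a near = because
      (+ 34 / 100 ⊙ 0≤r ⊕ diff z≤a ⊕ diff near) (solve (z ∷ r ∷ u ∷ a ∷ []) ring)
    lower-bound : ∀ z r u a → 0ℚ ≤ r → - z ≤ a → - (u - z) ≤ + 66 / 100 * r → - u ≤ a + r
    lower-bound z r u a 0≤r -z≤a near = because
      (+ 34 / 100 ⊙ 0≤r ⊕ diff -z≤a ⊕ diff near) (solve (z ∷ r ∷ u ∷ a ∷ []) ring)

  neg-/ : ∀ p j → - (p / suc j) ≡ (ℤ.- p) / suc j
  neg-/ p j = fromℚᵘ-neg (mkℚᵘ p j)

  module Search (z r : ℚ) (0<r : 0ℚ < r) where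

    0≤r : 0ℚ ≤ r
    0≤r = <⇒≤ 0<r

    N : ℕ
    N = proj₁ (archimedean-* 0<r 1ℚ)

    hit-denominator : ∀ p j → Hit z r p j → j ℕ.< N
    hit-denominator p j (rel , _) =
      relevant-denominator r N 0≤r (proj₂ (archimedean-* 0<r 1ℚ)) j rel

    B : ℚ
    B = (∣ z ∣ + r) * (+ N / 1)

    M : ℕ
    M = proj₁ (archimedean B)

    0≤∣z∣+r : 0ℚ ≤ ∣ z ∣ + r
    0≤∣z∣+r = 0≤∣p∣ z ⊕ 0≤r

    numerator≤ : ∀ p j → j ℕ.< N → p / suc j ≤ ∣ z ∣ + r → p ℤ.≤ + M
    numerator≤ p j j<N u≤ = /1-cancel-≤ {p} {+ M} (≤-trans
      (numerator-bound (p / 1) (recip j) (+ suc j / 1) (+ N / 1) (∣ z ∣ + r)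
        (subst (_≤ ∣ z ∣ + r) (sym (/1-*-recip p j)) u≤) (suc/1*recip≡1 j)
        0≤∣z∣+r (0≤n/1 (suc j)) (/1-mono-≤ {+ suc j} {+ N} (ℤ.+≤+ j<N)))
      (proj₂ (archimedean B)))

    hit-∣u∣ : ∀ p j → Hit z r p j → ∣ p / suc j ∣ ≤ ∣ z ∣ + r
    hit-∣u∣ p j h = ∣u∣-bound z r (p / suc j) 0≤r (hit-near z r p j h)

    hit-numerator⁺ : ∀ p j → Hit z r p j → p ℤ.≤ + M
    hit-numerator⁺ p j h = numerator≤ p j (hit-denominator p j h)
      (≤-trans (p≤∣p∣ (p / suc j)) (hit-∣u∣ p j h))

    hit-numerator⁻ : ∀ p j → Hit z r p j → ℤ.- p ℤ.≤ + M
    hit-numerator⁻ p j h = numerator≤ (ℤ.- p) j (hit-denominator p j h)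
      (≤-trans (≤-reflexive (sym (neg-/ p j))) -u≤)
      where
      -u≤ : - (p / suc j) ≤ ∣ z ∣ + r
      -u≤ = ≤-trans (-p≤∣p∣ (p / suc j)) (hit-∣u∣ p j h)

    -- Relevance bounds the denominator, and nearness to `z` then bounds the numerator. One range of
    -- `m` serves both constructors of the integers.
    Bounded : Set
    Bounded = ∃ λ j → j ℕ.< N × ∃ λ m → m ℕ.< suc M × (Hit z r (+ m) j ⊎ Hit z r -[1+ m ] j)

    bounded? : Dec Bounded
    bounded? = ℕ.anyUpTo? (λ j → ℕ.anyUpTo?
      (λ m → hit? z r (+ m) j ⊎-dec hit? z r -[1+ m ] j) (suc M)) N

    from-bounded : Bounded → ∃₂ λ p j → Hit z r p j
    from-bounded (j , _ , m , _ , inj₁ h) = + m , j , h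
    from-bounded (j , _ , m , _ , inj₂ h) = -[1+ m ] , j , h

    to-bounded : (∃₂ λ p j → Hit z r p j) → Bounded
    to-bounded (+ m , j , h) = j , hit-denominator (+ m) j h , m ,
      ℕ.s≤s (ℤ.drop‿+≤+ (hit-numerator⁺ (+ m) j h)) , inj₁ h
    to-bounded (-[1+ m ] , j , h) = j , hit-denominator -[1+ m ] j h , m ,
      ℕ.≤-trans (ℤ.drop‿+≤+ (hit-numerator⁻ -[1+ m ] j h)) (ℕ.n≤1+n M) , inj₂ h

    hits? : Dec (∃₂ λ p j → Hit z r p j)
    hits? = map′ from-bounded to-bounded bounded?

  -- The search may return any hit, since `hit-above` and `hit-below` handle all other relevant
  -- fractions by separation.
  safe-side : ∀ z r → 0ℚ < r → ∃ (Avoids z r)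
  safe-side z r 0<r = decide (Search.hits? z r 0<r)
    where
    beside : ∀ p j → Hit z r p j → z ≤ p / suc j ⊎ p / suc j ≤ z → ∃ (Avoids z r)
    beside p j h (inj₁ z≤u) = left , hit-above z r p j (<⇒≤ 0<r) h z≤u
    beside p j h (inj₂ u≤z) = right , hit-below z r p j (<⇒≤ 0<r) h u≤z

    decide : Dec (∃₂ λ p j → Hit z r p j) → ∃ (Avoids z r)
    decide (no none) = middle , unhit-middle z r none
    decide (yes (p , j , h)) = beside p j h (≤-total z (p / suc j))

  -- Position of Alice's ball.

  <⇒≱ : ∀ {p q} → p < q → ¬ (q ≤ p)
  <⇒≱ p<q q≤p = <-irrefl refl (<-≤-trans p<q q≤p)

  -- The offset of Alice's centre in units of (1 - α) times the radius, the largest shift that keeps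
  -- her ball inside.
  sign : Side → ℚ
  sign left   = - 1ℚ
  sign middle = 0ℚ
  sign right  = 1ℚ

  -1≤sign : ∀ s → - 1ℚ ≤ sign s
  -1≤sign left   = ≤-refl
  -1≤sign middle = <⇒≤ (negative⁻¹ (- 1ℚ))
  -1≤sign right  = ≤-trans (<⇒≤ (negative⁻¹ (- 1ℚ))) (<⇒≤ (positive⁻¹ 1ℚ))

  sign≤1 : ∀ s → sign s ≤ 1ℚ
  sign≤1 left   = ≤-trans (<⇒≤ (negative⁻¹ (- 1ℚ))) (<⇒≤ (positive⁻¹ 1ℚ))
  sign≤1 middle = <⇒≤ (positive⁻¹ 1ℚ)
  sign≤1 right  = ≤-refl

  ∣-∣≤⇒≤ : ∀ {p q} → ∣ p ∣ ≤ q → p ≤ q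
  ∣-∣≤⇒≤ {p} h = ≤-trans (p≤∣p∣ p) h

  ∣-∣≤⇒-≤ : ∀ {p q} → ∣ p ∣ ≤ q → - p ≤ q
  ∣-∣≤⇒-≤ {p} h = ≤-trans (-p≤∣p∣ p) h

  -- Here 1003/3000 is 1/3 + 1/1000. The ball is [c - ρ, c - (1 - 2a)ρ] with 1 - 2a at least
  -- 497/1500; errors of r/100 in the centre, r/100 in the radius and r/1000 in `x` fit into the
  -- zone.
  zone-left : ∀ z r c ρ a x → 0ℚ ≤ r → r ≤ ρ → ρ ≤ + 101 / 100 * r →
    ∣ c - z ∣ ≤ + 1 / 100 * r → a ≤ + 1003 / 3000 →
    ∣ x - (c + - 1ℚ * ((1ℚ - a) * ρ)) ∣ ≤ a * ρ + + 1 / 1000 * r → Zone left z r x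
  zone-left z r c ρ a x 0≤r r≤ρ ρ≤ c≈z a≤ x∈ =
    because
      (diff (∣-∣≤⇒-≤ x∈) ⊕ diff (∣-∣≤⇒-≤ c≈z) ⊕ diff ρ≤ ⊕ + 9 / 1000 ⊙ 0≤r)
      (solve (z ∷ r ∷ c ∷ ρ ∷ a ∷ x ∷ []) ring) ,
    because
      (diff (∣-∣≤⇒≤ x∈) ⊕ diff (∣-∣≤⇒≤ c≈z) ⊕ + 2 / 1 ⊙ diff a≤ ⊛ 0≤ρ
        ⊕ + 497 / 1500 ⊙ diff r≤ρ ⊕ + 31 / 3000 ⊙ 0≤r)
      (solve (z ∷ r ∷ c ∷ ρ ∷ a ∷ x ∷ []) ring)
    where
    0≤ρ : 0ℚ ≤ ρ
    0≤ρ = ≤-trans 0≤r r≤ρ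

  zone-middle : ∀ z r c ρ a x → 0ℚ ≤ r → r ≤ ρ → ρ ≤ + 101 / 100 * r →
    ∣ c - z ∣ ≤ + 1 / 100 * r → a ≤ + 1003 / 3000 →
    ∣ x - (c + 0ℚ * ((1ℚ - a) * ρ)) ∣ ≤ a * ρ + + 1 / 1000 * r → Zone middle z r x
  zone-middle z r c ρ a x 0≤r r≤ρ ρ≤ c≈z a≤ x∈ =
    because
      (diff (∣-∣≤⇒-≤ x∈) ⊕ diff (∣-∣≤⇒-≤ c≈z) ⊕ diff a≤ ⊛ 0≤ρ
        ⊕ + 1003 / 3000 ⊙ diff ρ≤ ⊕ + 397 / 300000 ⊙ 0≤r)
      (solve (z ∷ r ∷ c ∷ ρ ∷ a ∷ x ∷ []) ring) ,
    because
      (diff (∣-∣≤⇒≤ x∈) ⊕ diff (∣-∣≤⇒≤ c≈z) ⊕ diff a≤ ⊛ 0≤ρ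
        ⊕ + 1003 / 3000 ⊙ diff ρ≤ ⊕ + 397 / 300000 ⊙ 0≤r)
      (solve (z ∷ r ∷ c ∷ ρ ∷ a ∷ x ∷ []) ring)
    where
    0≤ρ : 0ℚ ≤ ρ
    0≤ρ = ≤-trans 0≤r r≤ρ

  zone-right : ∀ z r c ρ a x → 0ℚ ≤ r → r ≤ ρ → ρ ≤ + 101 / 100 * r →
    ∣ c - z ∣ ≤ + 1 / 100 * r → a ≤ + 1003 / 3000 →
    ∣ x - (c + 1ℚ * ((1ℚ - a) * ρ)) ∣ ≤ a * ρ + + 1 / 1000 * r → Zone right z r x
  zone-right z r c ρ a x 0≤r r≤ρ ρ≤ c≈z a≤ x∈ =
    because
      (diff (∣-∣≤⇒-≤ x∈) ⊕ diff (∣-∣≤⇒-≤ c≈z) ⊕ + 2 / 1 ⊙ diff a≤ ⊛ 0≤ρ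
        ⊕ + 497 / 1500 ⊙ diff r≤ρ ⊕ + 31 / 3000 ⊙ 0≤r)
      (solve (z ∷ r ∷ c ∷ ρ ∷ a ∷ x ∷ []) ring) ,
    because
      (diff (∣-∣≤⇒≤ x∈) ⊕ diff (∣-∣≤⇒≤ c≈z) ⊕ diff ρ≤ ⊕ + 9 / 1000 ⊙ 0≤r)
      (solve (z ∷ r ∷ c ∷ ρ ∷ a ∷ x ∷ []) ring)
    where
    0≤ρ : 0ℚ ≤ ρ
    0≤ρ = ≤-trans 0≤r r≤ρ

  zone : ∀ s z r c ρ a x → 0ℚ ≤ r → r ≤ ρ → ρ ≤ + 101 / 100 * r →
    ∣ c - z ∣ ≤ + 1 / 100 * r → a ≤ + 1003 / 3000 →
    ∣ x - (c + sign s * ((1ℚ - a) * ρ)) ∣ ≤ a * ρ + + 1 / 1000 * r → Zone s z r x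
  zone left   = zone-left
  zone middle = zone-middle
  zone right  = zone-right

  -- The shift |t|(1 - a)ρ and the radius aρ add up to at most ρ.
  subinterval : ∀ c ρ a t x ε → 0ℚ ≤ ρ → a ≤ 1ℚ → - 1ℚ ≤ t → t ≤ 1ℚ →
    ∣ x - (c + t * ((1ℚ - a) * ρ)) ∣ ≤ a * ρ + ε → ∣ x - c ∣ ≤ ρ + ε
  subinterval c ρ a t x ε 0≤ρ a≤1 -1≤t t≤1 x∈ = ∣p∣≤q
    (because (diff (∣-∣≤⇒≤ x∈) ⊕ diff t≤1 ⊛ diff a≤1 ⊛ 0≤ρ)
      (solve (c ∷ ρ ∷ a ∷ t ∷ x ∷ ε ∷ []) ring))
    (because (diff (∣-∣≤⇒-≤ x∈) ⊕ diff -1≤t ⊛ diff a≤1 ⊛ 0≤ρ)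
      (solve (c ∷ ρ ∷ a ∷ t ∷ x ∷ ε ∷ []) ring))

  -- Radii from one round to the next, compared with the margins.

  radius-halves : ∀ r r′ ρ ρ′ a b → 0ℚ ≤ r → 0ℚ ≤ ρ → ρ ≤ + 101 / 100 * r → r′ ≤ ρ′ →
    0ℚ ≤ a → a ≤ + 1003 / 3000 → b ≤ 1ℚ → ∣ ρ′ - b * (a * ρ) ∣ ≤ + 1 / 1000 * r →
    r′ ≤ ½ * r
  radius-halves r r′ ρ ρ′ a b 0≤r 0≤ρ ρ≤ r′≤ρ′ 0≤a a≤ b≤1 ρ′≈ = because
    (diff r′≤ρ′ ⊕ diff (∣-∣≤⇒≤ ρ′≈) ⊕ diff b≤1 ⊛ 0≤a ⊛ 0≤ρ ⊕ diff a≤ ⊛ 0≤ρ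
      ⊕ + 1003 / 3000 ⊙ diff ρ≤ ⊕ + 48397 / 300000 ⊙ 0≤r)
    (solve (r ∷ r′ ∷ ρ ∷ ρ′ ∷ a ∷ b ∷ []) ring)

  -- Even with the enlarged bound on `a`, ab/6 is at most 1003/18000, which is below 1/17.
  δX²≤X²/17 : ∀ a b W → 0ℚ ≤ a → a ≤ + 1003 / 3000 → b ≤ 1ℚ → 0ℚ ≤ W →
    a * b * (+ 1 / 6) * W ≤ + 1 / 17 * W
  δX²≤X²/17 a b W 0≤a a≤ b≤1 0≤W = because
    (+ 1 / 6 ⊙ 0≤W ⊛ 0≤a ⊛ diff b≤1 ⊕ + 1 / 6 ⊙ 0≤W ⊛ diff a≤ ⊕ + 949 / 306000 ⊙ 0≤W)
    (solve (a ∷ b ∷ W ∷ []) ring)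

  -- Irrelevance at radius `r` gives W ≤ 9r/5, so abW/6 ≤ 3abρ/10, which is about 3ρ′/10; the
  -- remaining r′/100 absorbs the errors.
  δX²≤31r/100 : ∀ r r′ ρ ρ′ a b W → 0ℚ ≤ r′ → r ≤ ρ → ρ′ ≤ + 101 / 100 * r′ →
    0ℚ ≤ a → 0ℚ ≤ b → ∣ ρ′ - b * (a * ρ) ∣ ≤ + 1 / 1000 * r′ →
    + 5 / 1 * W ≤ + 9 / 1 * r → a * b * (+ 1 / 6) * W ≤ + 31 / 100 * r′
  δX²≤31r/100 r r′ ρ ρ′ a b W 0≤r′ r≤ρ ρ′≤ 0≤a 0≤b ρ′≈ W≤ = because
    (+ 1 / 30 ⊙ 0≤a ⊛ 0≤b ⊛ diff W≤ ⊕ + 3 / 10 ⊙ 0≤a ⊛ 0≤b ⊛ diff r≤ρ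
      ⊕ + 3 / 10 ⊙ diff (∣-∣≤⇒-≤ ρ′≈) ⊕ + 3 / 10 ⊙ diff ρ′≤ ⊕ + 67 / 10000 ⊙ 0≤r′)
    (solve (r ∷ r′ ∷ ρ ∷ ρ′ ∷ a ∷ b ∷ W ∷ []) ring)

  -- In the application `ρ` and `σ` are two late samples of one radius and `ε` bounds it from below.
  -- Lowering `ρ` by ε/300 bounds all late samples from below, within a factor 101/100.
  radius-lower : ∀ ρ σ ε → ∣ ρ - σ ∣ ≤ + 1 / 300 * ε → ρ - + 1 / 300 * ε ≤ σ
  radius-lower ρ σ ε ρ≈σ = because (diff (∣-∣≤⇒≤ ρ≈σ)) (solve (ρ ∷ σ ∷ ε ∷ []) ring)

  radius-upper : ∀ ρ σ ε → 0ℚ ≤ ε → 0ℚ + ε ≤ ρ → ∣ ρ - σ ∣ ≤ + 1 / 300 * ε →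
    σ ≤ + 101 / 100 * (ρ - + 1 / 300 * ε)
  radius-upper ρ σ ε 0≤ε ε≤ρ ρ≈σ = because
    (diff (∣-∣≤⇒-≤ ρ≈σ) ⊕ + 1 / 100 ⊙ diff ε≤ρ ⊕ + 33 / 10000 ⊙ 0≤ε)
    (solve (ρ ∷ σ ∷ ε ∷ []) ring)

  radius-positive : ∀ ρ ε → 0ℚ + ε ≤ ρ → + 299 / 300 * ε ≤ ρ - + 1 / 300 * ε
  radius-positive ρ ε ε≤ρ = because (diff ε≤ρ) (solve (ρ ∷ ε ∷ []) ring)

  -- Shrinking radii and relevance in the long run.

  suc/1 : ∀ n → + suc n / 1 ≡ 1ℚ + + n / 1
  suc/1 n = trans (fromℚᵘ-cong {mkℚᵘ (+ suc n) 0} {mkℚᵘ (+ 1) 0 ℚᵘ.+ mkℚᵘ (+ n) 0}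
      (*≡* (cong (λ k → (+ 1 ℤ.+ k) ℤ.* + 1) (sym (ℤ.*-identityʳ (+ n))))))
    (sym (fromℚᵘ-+ (mkℚᵘ (+ 1) 0) (mkℚᵘ (+ n) 0)))

  -- Since (2 + K)/2 ≤ 1 + K, halving preserves the bound a/(n + 1) on the radii, which tends to 0
  -- and avoids powers of 2.
  decay-step : ∀ K r r′ a → 0ℚ ≤ K → 0ℚ ≤ r → r′ ≤ ½ * r → (1ℚ + K) * r ≤ a →
    (1ℚ + (1ℚ + K)) * r′ ≤ a
  decay-step K r r′ a 0≤K 0≤r r′≤ Kr≤a = because
    (diff Kr≤a ⊕ + 2 / 1 ⊙ diff r′≤ ⊕ 0≤K ⊛ diff r′≤ ⊕ ½ ⊙ 0≤K ⊛ 0≤r)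
    (solve (K ∷ r ∷ r′ ∷ a ∷ []) ring)

  module Halving (r : ℕ → ℚ) (0≤r : ∀ n → 0ℚ ≤ r n) (halves : ∀ n → r (suc n) ≤ ½ * r n) where

    decay : ∀ n → (1ℚ + + n / 1) * r n ≤ r 0
    decay zero    = ≤-reflexive (*-identityˡ (r 0))
    decay (suc n) = subst (λ k → (1ℚ + k) * r (suc n) ≤ r 0) (sym (suc/1 n))
      (decay-step (+ n / 1) (r n) (r (suc n)) (r 0) (0≤n/1 n) (0≤r n) (halves n) (decay n))

    eventually-small : ∀ {w} → 0ℚ < w → ∃ λ n → r n < w
    eventually-small {w} 0<w = small (archimedean-* 0<w (r 0))
      where
      -- The chain is (1 + K)w ≤ (1 + K)s ≤ a ≤ wK.
      too-large : ∀ K s a w → 0ℚ ≤ K → w ≤ s → (1ℚ + K) * s ≤ a → a ≤ w * K → w ≤ 0ℚ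
      too-large K s a w 0≤K w≤s Ks≤a a≤wK = because
        (diff w≤s ⊕ 0≤K ⊛ diff w≤s ⊕ diff Ks≤a ⊕ diff a≤wK)
        (solve (K ∷ s ∷ a ∷ w ∷ []) ring)

      small : (∃ λ N → r 0 ≤ w * (+ N / 1)) → ∃ λ n → r n < w
      small (N , r₀≤) = N , ≰⇒> (λ w≤r → <⇒≱ 0<w
        (too-large (+ N / 1) (r N) (r 0) w (0≤n/1 N) w≤r (decay N) r₀≤))

  scaled-half : ∀ r r′ → r′ ≤ ½ * r → + 9 / 1 * r′ ≤ ½ * (+ 9 / 1 * r)
  scaled-half r r′ r′≤ = because (+ 9 / 1 ⊙ diff r′≤) (solve (r ∷ r′ ∷ []) ring)

  eventually-relevant : ∀ (r : ℕ → ℚ) → (∀ n → 0ℚ ≤ r n) → (∀ n → r (suc n) ≤ ½ * r n) →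
    ∀ {X} → 0ℚ < X → ∃ λ n → Relevant (r n) X
  eventually-relevant r 0≤r halves 0<X = Halving.eventually-small (λ n → + 9 / 1 * r n)
    (λ n → + 9 / 1 ⊙ 0≤r n) (λ n → scaled-half (r n) (r (suc n)) (halves n))
    (*-pos (positive⁻¹ (+ 5 / 1)) (*-pos 0<X 0<X))

  -- The chain is 5X² ≤ 5X ≤ 5XrN ≤ 5XrQ = 5r ≤ 9r.
  irrelevant : ∀ r X Q N → 0ℚ ≤ r → 0ℚ ≤ X → X ≤ 1ℚ → Q * X ≡ 1ℚ → 1ℚ ≤ r * N → N ≤ Q →
    + 5 / 1 * (X * X) ≤ + 9 / 1 * r
  irrelevant r X Q N 0≤r 0≤X X≤1 QX≡1 1≤rN N≤Q = because
    (+ 5 / 1 ⊙ 0≤X ⊛ diff X≤1 ⊕ + 5 / 1 ⊙ 0≤X ⊛ diff 1≤rN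
      ⊕ + 5 / 1 ⊙ 0≤X ⊛ 0≤r ⊛ diff N≤Q ⊕ + 5 / 1 ⊙ 0≤r ⊛ diff (≤-reflexive QX≡1)
      ⊕ + 4 / 1 ⊙ 0≤r)
    (solve (r ∷ X ∷ Q ∷ N ∷ []) ring)

  -- This supplies the threshold in `Bad`: beyond it a denominator is irrelevant at the start, so
  -- some round takes it from irrelevant to relevant.
  eventually-irrelevant : ∀ {r} → 0ℚ < r →
    ∃ λ N → ∀ j → N ℕ.≤ j → ¬ Relevant r (recip j)
  eventually-irrelevant {r} 0<r = from-bound (archimedean-* 0<r 1ℚ)
    where
    from-bound : (∃ λ N → 1ℚ ≤ r * (+ N / 1)) → ∃ λ N → ∀ j → N ℕ.≤ j → ¬ Relevant r (recip j)
    from-bound (N , 1≤rN) = N , λ j N≤j rel → <⇒≱ rel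
      (irrelevant r (recip j) (+ suc j / 1) (+ N / 1) (<⇒≤ 0<r) (<⇒≤ (0<recip j)) (recip≤1 j)
        (suc/1*recip≡1 j) 1≤rN (/1-mono-≤ {+ N} {+ suc j} (ℤ.+≤+ (ℕ.≤-trans N≤j (ℕ.n≤1+n j)))))

  half-contradiction : ∀ {d e} → 0ℚ < d → d ≤ e → ¬ (e ≤ ½ * d)
  half-contradiction {d} {e} 0<d d≤e e≤ = <⇒≱ 0<d (because
    (+ 2 / 1 ⊙ diff d≤e ⊕ + 2 / 1 ⊙ diff e≤) (solve (d ∷ e ∷ []) ring))

  product-lower : ∀ ε η a b → 0ℚ ≤ ε → 0ℚ ≤ η → 0ℚ + ε ≤ a → 0ℚ + η ≤ b →
    0ℚ + ε * η ≤ a * b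
  product-lower ε η a b 0≤ε 0≤η ε≤a η≤b = because
    (diff ε≤a ⊛ diff η≤b ⊕ 0≤ε ⊛ diff η≤b ⊕ 0≤η ⊛ diff ε≤a)
    (solve (ε ∷ η ∷ a ∷ b ∷ []) ring)

  widen : ∀ {a b ε} → 0ℚ ≤ ε → a ≤ b → a ≤ b + ε
  widen {a} {b} {ε} 0≤ε a≤b = because (diff a≤b ⊕ 0≤ε) (solve (a ∷ b ∷ ε ∷ []) ring)

open import Defs
open import Data.Integer.Base using (+_)
open import Data.Rational.Base using (_/_)
open import Data.Empty using (⊥)
open import Data.Integer.Base as ℤ using (ℤ)
import Data.Integer.Coprimality as ℤ
open import Data.Nat.Base as ℕ using (ℕ; zero; suc)
import Data.Nat.Properties as ℕ
open import Data.Product.Base using (∃; _×_; _,_; proj₁; proj₂; uncurry)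
open import Data.Rational.Base as ℚ using (ℚ; 0ℚ; 1ℚ; ½)
import Data.Rational.Properties as ℚ
open import Relation.Binary.PropositionalEquality using (sym; cong; subst)
open import Relation.Nullary.Decidable using (Dec; yes; no; from-yes)
open import Relation.Nullary.Negation using (¬_; contradiction)
open import Relation.Unary using (_∈_)

open Rationals

-- Eventual statements and rational approximations of balls.

both : ∀ {P Q} → Eventually P → Eventually Q → Eventually (λ n → P n × Q n)
both (M , p) (N , q) = M ℕ.⊔ N , λ n h → p n (⊔-l {M} {N} h) , q n (⊔-r {M} {N} h)

eventually-map : ∀ {P Q : ℕ → Set} → (∀ n → P n → Q n) → Eventually P → Eventually Q
eventually-map f (N , p) = N , λ n h → f n (p n h)

sometime : ∀ {P : ℕ → Set} → Eventually P → ∃ P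
sometime (N , p) = N , p N ℕ.≤-refl

-- The search runs down from the given success until it meets a failure, at 0 at the latest; any
-- switch from failure to success will do.
first-success : ∀ {P : ℕ → Set} → (∀ n → Dec (P n)) → ¬ P 0 → ∀ n → P n →
  ∃ λ m → ¬ P m × P (suc m)
first-success P? ¬P0 zero    p = contradiction p ¬P0
first-success P? ¬P0 (suc n) p with P? n
... | yes pn = first-success P? ¬P0 n pn
... | no ¬pn = n , ¬pn , p

record Approximation (b : Ball) : Set where
  field
    z r   : ℚ
    0<r   : 0ℚ ℚ.< r
    close : Eventually λ n →
      r ℚ.≤ seq (radius b) n × seq (radius b) n ℚ.≤ + 101 / 100 ℚ.* r ×
      ℚ.∣ seq (centre b) n ℚ.- z ∣ ℚ.≤ + 1 / 100 ℚ.* r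

-- The radius comes first, because the tolerance for the centre is a fraction of `r`.
approximate : ∀ b → Approximation b
approximate b = from-lower (radius>0 b)
  where
  ρ : ℕ → ℚ
  ρ = seq (radius b)

  from-lower : 0ℝ < radius b → Approximation b
  from-lower (ε , 0<ε , L , ε≤ρ) =
    from-radius (cauchy (radius b) (+ 1 / 300 ℚ.* ε) (*-pos (ℚ.positive⁻¹ (+ 1 / 300)) 0<ε))
    where
    from-radius : (∃ λ M → ∀ m n → M ℕ.≤ m → M ℕ.≤ n →
      ℚ.∣ ρ m ℚ.- ρ n ∣ ℚ.≤ + 1 / 300 ℚ.* ε) → Approximation b
    from-radius (M , ρ-close) =
      from-centre (cauchy (centre b) (+ 1 / 100 ℚ.* r) (*-pos (ℚ.positive⁻¹ (+ 1 / 100)) 0<r))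
      where
      K : ℕ
      K = L ℕ.⊔ M

      r : ℚ
      r = ρ K ℚ.- + 1 / 300 ℚ.* ε

      ε≤ρK : 0ℚ ℚ.+ ε ℚ.≤ ρ K
      ε≤ρK = ε≤ρ K (ℕ.m≤m⊔n L M)

      0<r : 0ℚ ℚ.< r
      0<r = ℚ.<-≤-trans (*-pos (ℚ.positive⁻¹ (+ 299 / 300)) 0<ε) (radius-positive (ρ K) ε ε≤ρK)

      ρK≈ρ : ∀ n → M ℕ.≤ n → ℚ.∣ ρ K ℚ.- ρ n ∣ ℚ.≤ + 1 / 300 ℚ.* ε
      ρK≈ρ n M≤n = ρ-close K n (ℕ.m≤n⊔m L M) M≤n

      from-centre : (∃ λ N → ∀ m n → N ℕ.≤ m → N ℕ.≤ n →
        ℚ.∣ seq (centre b) m ℚ.- seq (centre b) n ∣ ℚ.≤ + 1 / 100 ℚ.* r) → Approximation b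
      from-centre (N , c-close) = record
        { z = seq (centre b) N
        ; r = r
        ; 0<r = 0<r
        ; close = M ℕ.⊔ N , λ n h →
            radius-lower (ρ K) (ρ n) ε (ρK≈ρ n (⊔-l {M} {N} h)) ,
            radius-upper (ρ K) (ρ n) ε (ℚ.<⇒≤ 0<ε) ε≤ρK (ρK≈ρ n (⊔-l {M} {N} h)) ,
            c-close n N (⊔-r {M} {N} h) ℕ.≤-refl
        }

<⇒eventually-≤ : ∀ {x y} → x < y → Eventually λ n → seq x n ℚ.≤ seq y n
<⇒eventually-≤ {x} (ε , 0<ε , h) =
  eventually-map (λ n → drop-summand (seq x n) ε _ (ℚ.<⇒≤ 0<ε)) h

*-positive : ∀ {x y} → 0ℝ < x → 0ℝ < y → 0ℝ < x * y
*-positive {x} {y} (ε , 0<ε , h) (η , 0<η , k) = ε ℚ.* η , *-pos 0<ε 0<η ,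
  eventually-map (λ n (ε≤x , η≤y) →
    product-lower ε η (seq x n) (seq y n) (ℚ.<⇒≤ 0<ε) (ℚ.<⇒≤ 0<η) ε≤x η≤y) (both h k)

-- Alice's strategy.

module Alice (α : ℝ) (0<α : 0ℝ < α) (α≤⅓ : α ≤ fromℚ (+ 1 / 3)) where

  z r : Ball → ℚ
  z b = Approximation.z (approximate b)
  r b = Approximation.r (approximate b)

  0<r : ∀ b → 0ℚ ℚ.< r b
  0<r b = Approximation.0<r (approximate b)

  0≤r : ∀ b → 0ℚ ℚ.≤ r b
  0≤r b = ℚ.<⇒≤ (0<r b)

  side : Ball → Side
  side b = proj₁ (safe-side (z b) (r b) (0<r b))

  answer : Ball → Ball
  answer b = mkBall (centre b + fromℚ (sign (side b)) * ((1ℝ - α) * radius b))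
    (α * radius b) (*-positive {α} {radius b} 0<α (radius>0 b))

  α-bounds : Eventually λ n → 0ℚ ℚ.≤ seq α n × seq α n ℚ.≤ + 1003 / 3000
  α-bounds = both (<⇒eventually-≤ {0ℝ} {α} 0<α) (α≤⅓ (+ 1 / 1000) (ℚ.positive⁻¹ (+ 1 / 1000)))

  answer-legal : ∀ b → answer b ∈ b ^ α
  answer-legal b = (λ {x} x∈A ε 0<ε → eventually-map
      (λ n (x∈ , (_ , α≤) , r≤ρ , _) → subinterval (seq (centre b) n) (seq (radius b) n)
        (seq α n) (sign (side b)) (seq x n) ε (ℚ.≤-trans (0≤r b) r≤ρ)
        (ℚ.≤-trans α≤ (from-yes (+ 1003 / 3000 ℚ.≤? 1ℚ)))
        (-1≤sign (side b)) (sign≤1 (side b)) x∈)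
      (both (x∈A ε 0<ε) (both α-bounds (Approximation.close (approximate b))))) ,
    -- The radius of `answer b` is `α * radius b` by definition, so the two sequences agree at every
    -- index.
    λ ε 0<ε → 0 , λ n _ → subst (ℚ._≤ ε)
      (sym (cong ℚ.∣_∣ (ℚ.+-inverseʳ (seq α n ℚ.* seq (radius b) n)))) (ℚ.<⇒≤ 0<ε)

  strategy : Strategy α
  strategy _ b = answer b , answer-legal b

  answer-avoids : ∀ b x → x ∈ ⟦ answer b ⟧ → ∀ p j → Relevant (r b) (recip j) →
    Eventually λ n → margin (r b) (recip j) ℚ.≤ ℚ.∣ seq x n ℚ.- p / suc j ∣
  answer-avoids b x x∈A p j rel = eventually-map
    (λ n (x∈ , (_ , α≤) , r≤ρ , ρ≤ , c≈z) →
      proj₂ (safe-side (z b) (r b) (0<r b)) p j rel (seq x n)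
        (zone (side b) (z b) (r b) (seq (centre b) n) (seq (radius b) n) (seq α n) (seq x n)
          (0≤r b) r≤ρ ρ≤ c≈z α≤ x∈))
    (both (x∈A (+ 1 / 1000 ℚ.* r b) (*-pos (ℚ.positive⁻¹ (+ 1 / 1000)) (0<r b)))
      (both α-bounds (Approximation.close (approximate b))))

-- An arbitrary play against the strategy.

module Play (α β : ℝ) (0<α : 0ℝ < α) (α≤⅓ : α ≤ fromℚ (+ 1 / 3)) (0<β : 0ℝ < β) (β<1 : β < 1ℝ)
  (B : ℕ → Ball) (legal : Legal α β (Alice.strategy α 0<α α≤⅓) B)
  (x : ℝ) (x∈B : ∀ n → x ∈ ⟦ B n ⟧) where

  open Alice α 0<α α≤⅓

  rₙ : ℕ → ℚ
  rₙ n = r (B n)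

  close : ∀ n → Eventually λ k →
    rₙ n ℚ.≤ seq (radius (B n)) k × seq (radius (B n)) k ℚ.≤ + 101 / 100 ℚ.* rₙ n ×
    ℚ.∣ seq (centre (B n)) k ℚ.- z (B n) ∣ ℚ.≤ + 1 / 100 ℚ.* rₙ n
  close n = Approximation.close (approximate (B n))

  β-bounds : Eventually λ k → 0ℚ ℚ.≤ seq β k × seq β k ℚ.≤ 1ℚ
  β-bounds = both (<⇒eventually-≤ {0ℝ} {β} 0<β) (<⇒eventually-≤ {β} {1ℝ} β<1)

  -- The tolerance is left open: `halves` takes the radius before the round, `δX²≤margin` the one
  -- after it.
  next-radius : ∀ n {ε} → 0ℚ ℚ.< ε → Eventually λ k →
    ℚ.∣ seq (radius (B (suc n))) k ℚ.- seq β k ℚ.* (seq α k ℚ.* seq (radius (B n)) k) ∣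
      ℚ.≤ + 1 / 1000 ℚ.* ε
  next-radius n 0<ε = proj₂ (legal n) _ (*-pos (ℚ.positive⁻¹ (+ 1 / 1000)) 0<ε)

  halves : ∀ n → rₙ (suc n) ℚ.≤ ½ ℚ.* rₙ n
  -- The claim does not depend on `k`, so one common index suffices.
  halves n = proj₂ (sometime (eventually-map
    (λ k ((r≤ρ , ρ≤ , _) , (r′≤ρ′ , _) , (0≤α , α≤) , (_ , β≤1) , ρ′≈) →
      radius-halves (rₙ n) (rₙ (suc n)) (seq (radius (B n)) k) (seq (radius (B (suc n))) k)
        (seq α k) (seq β k) (0≤r (B n)) (ℚ.≤-trans (0≤r (B n)) r≤ρ) ρ≤ r′≤ρ′ 0≤α α≤ β≤1 ρ′≈)
    (both (close n) (both (close (suc n)) (both α-bounds (both β-bounds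
      (next-radius n (0<r (B n)))))))))

  reach : ∀ j → ∃ λ n → Relevant (rₙ n) (recip j)
  reach j = eventually-relevant rₙ (λ n → 0≤r (B n)) halves (0<recip j)

  avoids : ∀ n p j → Relevant (rₙ n) (recip j) →
    Eventually λ k → margin (rₙ n) (recip j) ℚ.≤ ℚ.∣ seq x k ℚ.- p / suc j ∣
  -- The point lies in Bob's next ball, hence in Alice's answer to `B n`.
  avoids n = answer-avoids (B n) x (proj₁ (legal n) {x} (x∈B (suc n)))

  δX²≤margin : ∀ n j → ¬ Relevant (rₙ n) (recip j) → Eventually λ k →
    seq α k ℚ.* seq β k ℚ.* (+ 1 / 6) ℚ.* (recip j ℚ.* recip j)
      ℚ.≤ margin (rₙ (suc n)) (recip j)
  δX²≤margin n j irrel = eventually-map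
    (λ k ((r≤ρ , _) , (_ , ρ′≤ , _) , (0≤α , α≤) , (0≤β , β≤1) , ρ′≈) → ℚ.⊓-glb
      (δX²≤X²/17 (seq α k) (seq β k) (recip j ℚ.* recip j) 0≤α α≤ β≤1
        (ℚ.<⇒≤ (*-pos (0<recip j) (0<recip j))))
      (δX²≤31r/100 (rₙ n) (rₙ (suc n)) (seq (radius (B n)) k) (seq (radius (B (suc n))) k)
        (seq α k) (seq β k) (recip j ℚ.* recip j) (0≤r (B (suc n))) r≤ρ ρ′≤ 0≤α 0≤β ρ′≈
        (ℚ.≮⇒≥ irrel)))
    (both (close n) (both (close (suc n)) (both α-bounds (both β-bounds
      (next-radius n (0<r (B (suc n))))))))

  -- Once the denominator of `q` is relevant, `x` keeps a positive distance `d` from `q`, whereas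
  -- equality would bring its sequence within d/2.
  irrational : Irrational x
  irrational q x≈q = refute (reach (ℚ.denominator-1 q))
    where
    refute : (∃ λ n → Relevant (rₙ n) (recip (ℚ.denominator-1 q))) → ⊥
    refute (n , rel) = uncurry (half-contradiction 0<d) (proj₂ (sometime (both
        (subst (λ v → Eventually λ k → d ℚ.≤ ℚ.∣ seq x k ℚ.- v ∣) (ℚ.↥p/↧p≡p q)
          (avoids n (ℚ.numerator q) (ℚ.denominator-1 q) rel))
        (x≈q (½ ℚ.* d) (½-pos 0<d)))))
      where
      d : ℚ
      d = margin (rₙ n) (recip (ℚ.denominator-1 q))
      0<d : 0ℚ ℚ.< d
      0<d = margin>0 (0<r (B n)) (0<recip (ℚ.denominator-1 q))

  -- At a switch from irrelevant at `n` to relevant at `suc n`, the former puts αβ/(6q²) below the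
  -- margin and the latter makes the margin a distance.
  far : ∀ p j → ¬ Relevant (rₙ 0) (recip j) → Eventually λ k →
    seq α k ℚ.* seq β k ℚ.* (+ 1 / 6) ℚ.* (recip j ℚ.* recip j)
      ℚ.≤ ℚ.∣ seq x k ℚ.- p / suc j ∣
  far p j irrel₀ = at (first-success {λ n → Relevant (rₙ n) (recip j)} (λ n → _ ℚ.<? _) irrel₀
    (proj₁ (reach j)) (proj₂ (reach j)))
    where
    at : (∃ λ n → ¬ Relevant (rₙ n) (recip j) × Relevant (rₙ (suc n)) (recip j)) → Eventually λ k →
      seq α k ℚ.* seq β k ℚ.* (+ 1 / 6) ℚ.* (recip j ℚ.* recip j)
        ℚ.≤ ℚ.∣ seq x k ℚ.- p / suc j ∣
    at (n , irrel , rel) = eventually-map (λ k (δ≤ , ≤d) → ℚ.≤-trans δ≤ ≤d)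
      (both (δX²≤margin n j irrel) (avoids (suc n) p j rel))

  badly-approximable : ∀ p j → ¬ Relevant (rₙ 0) (recip j) →
    (((α * β) ÷ 6) ÷ (suc j ℕ.^ 2)) {{ℕ.m^n≢0 (suc j) 2}} ≤ ∣ x - fromℚ (p / suc j) ∣
  badly-approximable p j irrel ε 0<ε = eventually-map
    (λ k δ≤ → widen (ℚ.<⇒≤ 0<ε) (subst
      (λ w → seq α k ℚ.* seq β k ℚ.* (+ 1 / 6) ℚ.* w ℚ.≤ ℚ.∣ seq x k ℚ.- p / suc j ∣)
      (recip*recip j) δ≤))
    (far p j irrel)

  bad : Bad ((α * β) ÷ 6) x
  bad = irrational , beyond (eventually-irrelevant (0<r (B 0)))
    where
    beyond : (∃ λ N → ∀ j → N ℕ.≤ j → ¬ Relevant (rₙ 0) (recip j)) →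
      ∃ λ (Q : ℕ) → 0 ℕ.< Q ×
        (∀ (q : ℕ) .{{_ : ℕ.NonZero q}} → Q ℕ.≤ q → ∀ (p : ℤ) → ℤ.Coprime p (+ q) →
         (((α * β) ÷ 6) ÷ (q ℕ.^ 2)) {{ℕ.m^n≢0 q 2}} ≤ ∣ x - fromℚ (p / q) ∣)
    -- Denominators have the form `suc j` and irrelevance is known for `j` from `N` on, so the
    -- threshold is `suc N`.
    beyond (N , irrel) = suc N , ℕ.s≤s ℕ.z≤n , λ where
      (suc j) (ℕ.s≤s N≤j) p _ → badly-approximable p j (irrel j N≤j)

theorem1p8 : (α β : ℝ) → 0ℝ < α → α ≤ fromℚ (+ 1 / 3) → 0ℝ < β → β < 1ℝ →
    Winning α β (Bad ((α * β) ÷ 6))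
theorem1p8 α β 0<α α≤⅓ 0<β β<1 = Alice.strategy α 0<α α≤⅓ ,
  λ B legal x x∈B → Play.bad α β 0<α α≤⅓ 0<β β<1 B legal x x∈B
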